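{- For each gadget $G$ in the following list of twelve AND gadgets, the remaining gadgets in that same list can be constructed from $G$, the red bend gadget, and any OR gadget: (1) $R\cdot\cdot|\cdot RB$, (2) $\cdot R\cdot|R\cdot B$, (3) $\cdots|RRB$, (4) $\cdot\cdot B|RR\cdot$, (5) $\cdots|BRR$, (6) $\cdot\cdot R|BR\cdot$, (7) $B\cdot\cdot|\cdot RR$, (8) $\cdot R\cdot|B\cdot R$, (9) $\cdots|RBR$, (10) $R\cdot\cdot|\cdot BR$, (11) $\cdot B\cdot|R\cdot R$, and (12) $\cdot\cdot R|RB\cdot$.
   Context: Nondeterministic Constraint Logic (NCL). Edges are red (weight 1) or blue (weight 2) and are directed; each vertex has three incident edges, and the sum of weights of the edges directed into each vertex must be at least 2 (minimum inflow constraint). An OR vertex has three blue incident edges, so its constraint is: at least one of its three edges is directed into it. An AND vertex has one blue and two red incident edges, so its constraint is: the blue edge is directed into it, or both red edges are directed into it. Gadget patterns. A gadget represents a vertex drawn as a vertical segment with three horizontal tunnels (edges) attached at three distinct heights, each leaving on the left or on the right. The pattern $x_1x_2x_3|y_1y_2y_3$ records this: for each $i\in\{1,2,3\}$ (from top to bottom) exactly one of $x_i,y_i$ is the symbol $\cdot$ and the other is a color, $B$ (blue) or $R$ (red); if $x_i$ is the color then the $i$-th tunnel leaves on the left, and if $y_i$ is the color it leaves on the right. An OR gadget is one whose three colors are all $B$ and which satisfies the constraint of an OR vertex; an AND gadget is one with one $B$ and two $R$'s which satisfies the constraint of an AND vertex. The mirror image of a gadget (reflection about a vertical axis) exchanges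 left and right, keeps heights, and is considered available whenever the gadget is. Red bend gadget. This is a component drawn as a vertical segment with exactly two tunnels, both red and both on the same side (left or right), whose constraint is that at least one of its two edges is directed into it (inflow at least 1). Constrained blue edge terminator. This is a component with a single blue tunnel (on the left or on the right) such that the edge represented by that tunnel is forced to be directed into the terminator; it is available for free from any OR gadget. Construction. A gadget with a given pattern "can be constructed from $G$, the red bend gadget, and any OR gadget" if, whichever OR gadget $O$ is supplied, there is a finite assembly as follows. Components are copies of $G$, of the red bend gadget, of $O$, constrained blue edge terminators, gadgets already constructed from these in this way (including further OR gadgets), and mirror images of all of these. Components are drawn as pairwise disjoint vertical segments, of arbitrary height and with arbitrary spacing of their tunnels, respecting the top-to-bottom order and the sides in their patterns. Each tunnel is a horizontal segment that either joins a right tunnel entry of one component to a left tunnel entry, of the same color, of another component, or is external, i.e., extends indefinitely to the left or to the right (on its side). No other intersections or overlaps of segments occur. Exactly three tunnels are external, at distinct heights, and their sides and colors from top to bottom form the required pattern. Finally, the assembly satisfies the same constraints as an NCL AND vertex: an assignment of directions to the three external edges can be extended to directions of all internal edges satisfying the constraint of every component if and only if the external blue edge is directed into the assembly or both external red edges are directed into the assembly. (For an intermediate assembly that is an OR gadget, the corresponding condition is that at least one of its three external blue edges is directed into the assembly.) -}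

module Defs where

open import Data.Fin using (Fin) renaming (_<_ to _<ᶠ_)
open import Data.Integer using (ℤ; _≤_; _<_)
open import Data.Nat using (ℕ) renaming (_≤_ to _≤ⁿ_)
open import Data.Product using (Σ; ∃-syntax; _×_; _,_)
open import Data.Sum using (_⊎_; inj₁; inj₂; [_,_]′)
open import Data.Vec using (Vec; []; _∷_; lookup; map; sum; tabulate; count)
open import Function.Bundles using (_↔_; _⇔_; Inverse)
open import Relation.Binary.PropositionalEquality using (_≡_; _≢_; refl)
open import Relation.Nullary using (Dec; yes; no)
open import Relation.Unary using (Pred; _∈_; _⊥_)
open import Level using (0ℓ)

------------------------------------------------------------------------
-- Patterns and constraints

data Color : Set where
  R B : Color

_≟ᶜ_ : (c d : Color) → Dec (c ≡ d)
R ≟ᶜ R = yes refl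
R ≟ᶜ B = no λ ()
B ≟ᶜ R = no λ ()
B ≟ᶜ B = yes refl

weight : Color → ℕ
weight R = 1
weight B = 2

data Side : Set where
  left right : Side

-- One row xᵢ|yᵢ of a pattern: the tunnel at that height leaves on the left
-- (c ∣·) or on the right (·∣ c).
infix 6 _∣· ·∣_
data Entry : Set where
  _∣· ·∣_ : Color → Entry

color : Entry → Color
color (c ∣·) = c
color (·∣ c) = c

side : Entry → Side
side (_ ∣·) = left
side (·∣ _) = right

flip : Entry → Entry
flip (c ∣·) = ·∣ c
flip (·∣ c) = c ∣·

-- The pattern x₁x₂x₃|y₁y₂y₃, listed by rows from top to bottom.
Pattern : Set
Pattern = Vec Entry 3

blues : Pattern → ℕ
blues = count (λ e → color e ≟ᶜ B)

IsAnd IsOr : Pattern → Set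
IsAnd P = blues P ≡ 1
IsOr  P = blues P ≡ 3

-- The direction of a (horizontal) edge is the side it points towards, so an
-- edge leaving a component on the left is directed into that component
-- exactly when it points to the right, and vice versa.
Direction : Set
Direction = Side

inflow₁ : Entry → Direction → ℕ
inflow₁ (c ∣·) right = weight c
inflow₁ (c ∣·) left  = 0
inflow₁ (·∣ c) left  = weight c
inflow₁ (·∣ c) right = 0

inflow : ∀ {n} → Vec Entry n → (Fin n → Direction) → ℕ
inflow es d = sum (tabulate λ k → inflow₁ (lookup es k) (d k))

record Component : Set where
  constructor component
  field
    {arity}   : ℕ
    entries   : Vec Entry arity      -- from top to bottom
    minInflow : ℕ
open Component public

mirror : Component → Component
mirror (component es m) = component (map flip es) m

-- Minimum inflow 2 is the constraint of every NCL vertex: on three blue edges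
-- it says that one of them is directed in, on one blue and two red edges that
-- the blue one or both red ones are.
gadget : Pattern → Component
gadget P = component P 2

redBend : Component
redBend = component (R ∣· ∷ R ∣· ∷ []) 1

-- Inflow 2 forces the only edge, of weight 2, to be directed in.
terminator : Component
terminator = component (B ∣· ∷ []) 2

------------------------------------------------------------------------
-- Networks of components

-- The ends of tunnels at components, given m internal tunnels: the end of an
-- internal tunnel at the component on its left, its end at the component on
-- its right, or the only end of one of the three external tunnels.
data End (m : ℕ) : Set where
  start finish : Fin m → End m
  outer        : Fin 3 → End m

Tunnel : ℕ → Set
Tunnel m = Fin m ⊎ Fin 3

tunnelOf : ∀ {m} → End m → Tunnel m
tunnelOf (start t)  = inj₁ t
tunnelOf (finish t) = inj₁ t
tunnelOf (outer i)  = inj₂ i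

-- Components and the tunnels joining them; the external tunnels, numbered from
-- top to bottom, form the pattern P.
record Network (P : Pattern) : Set where
  field
    size      : ℕ
    part      : Fin size → Component
    internals : ℕ

  Port : Set
  Port = Σ (Fin size) λ i → Fin (arity (part i))

  entry : Port → Entry
  entry (i , k) = lookup (entries (part i)) k

  field
    -- Every port is an end of exactly one tunnel.
    ends : End internals ↔ Port

  portAt : End internals → Port
  portAt = Inverse.to ends

  tunnelAt : Port → Tunnel internals
  tunnelAt p = tunnelOf (Inverse.from ends p)

  field
    start-side  : ∀ t → side (entry (portAt (start t))) ≡ right
    finish-side : ∀ t → side (entry (portAt (finish t))) ≡ left
    same-color  : ∀ t → color (entry (portAt (start t))) ≡ color (entry (portAt (finish t)))
    outer-entry : ∀ i → entry (portAt (outer i)) ≡ lookup P i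

  Satisfied : (Tunnel internals → Direction) → Set
  Satisfied d = ∀ i → minInflow (part i) ≤ⁿ
                      inflow (entries (part i)) (λ k → d (tunnelAt (i , k)))

  -- An assignment d of directions to the external edges extends to the internal
  -- edges iff it satisfies the constraint of the gadget with pattern P.
  BehavesAsGadget : Set
  BehavesAsGadget = (d : Fin 3 → Direction) →
                    (∃[ e ] Satisfied [ e , d ]′) ⇔ 2 ≤ⁿ inflow P d

------------------------------------------------------------------------
-- Drawings

-- A drawing is finite and only the relative order of its coordinates matters,
-- so integer coordinates lose no generality; moreover, axis-parallel segments
-- with integer endpoints meet iff they meet in an integer point.
Point : Set
Point = ℤ × ℤ

-- A larger second coordinate is higher.
record Placement (c : Component) : Set where
  field
    abscissa   : ℤ
    bottom top : ℤ
    height     : Fin (arity c) → ℤ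
    bottom<top : bottom < top
    attached   : ∀ k → bottom ≤ height k × height k ≤ top
    descending : ∀ {k l} → k <ᶠ l → height l < height k

  body : Pred Point 0ℓ
  body (x , y) = x ≡ abscissa × bottom ≤ y × y ≤ top

-- The points to the given side of abscissa a, including a itself.
ray : Side → ℤ → Pred ℤ 0ℓ
ray left  a x = x ≤ a
ray right a x = a ≤ x

module Segments {P : Pattern} (N : Network P)
                (place : ∀ i → Placement (Network.part N i)) where
  open Network N

  X Y : Port → ℤ
  X (i , k) = Placement.abscissa (place i)
  Y (i , k) = Placement.height (place i) k

  body : Fin size → Pred Point 0ℓ
  body i = Placement.body (place i)

  segment : Tunnel internals → Pred Point 0ℓ
  segment (inj₁ t) (x , y) = y ≡ Y (portAt (start t)) ×
                             X (portAt (start t)) ≤ x × x ≤ X (portAt (finish t))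
  segment (inj₂ i) (x , y) = y ≡ Y (portAt (outer i)) ×
                             x ∈ ray (side (lookup P i)) (X (portAt (outer i)))

record Drawing {P : Pattern} (N : Network P) : Set where
  open Network N

  field
    place : ∀ i → Placement (part i)

  open Segments N place

  field
    rightwards       : ∀ t → X (portAt (start t)) < X (portAt (finish t))
    horizontal       : ∀ t → Y (portAt (start t)) ≡ Y (portAt (finish t))
    outer-descending : ∀ {i j} → i <ᶠ j → Y (portAt (outer j)) < Y (portAt (outer i))
    bodies-disjoint  : ∀ {i j} → i ≢ j → body i ⊥ body j
    tunnels-disjoint : ∀ {s t} → s ≢ t → segment s ⊥ segment t
    -- A tunnel meets a component only at a port where it is attached.
    body-tunnel      : ∀ i t {p} → p ∈ body i → p ∈ segment t →
                       ∃[ k ] tunnelAt (i , k) ≡ t × p ≡ (X (i , k) , Y (i , k))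

------------------------------------------------------------------------
-- Constructibility from the gadget G, the red bend gadget and the OR gadget O

mutual
  data Available (G O : Pattern) : Component → Set where
    source      : Available G O (gadget G)
    or          : Available G O (gadget O)
    bend        : Available G O redBend
    terminate   : Available G O terminator
    constructed : ∀ {P} → Constructible G O P → Available G O (gadget P)
    mirrored    : ∀ {c} → Available G O c → Available G O (mirror c)

  data Constructible (G O : Pattern) : Pattern → Set where
    assemble : ∀ {P} → IsAnd P ⊎ IsOr P → (N : Network P) →
               (∀ i → Available G O (Network.part N i)) →
               Drawing N → Network.BehavesAsGadget N → Constructible G O P

andGadgets : Vec Pattern 12
andGadgets =
  ( R ∣· ∷ ·∣ R ∷ ·∣ B ∷ []) ∷   -- R··|·RB
  (·∣ R  ∷ R ∣· ∷ ·∣ B ∷ []) ∷   -- ·R·|R·B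
  (·∣ R  ∷ ·∣ R ∷ ·∣ B ∷ []) ∷   -- ···|RRB
  (·∣ R  ∷ ·∣ R ∷ B ∣· ∷ []) ∷   -- ··B|RR·
  (·∣ B  ∷ ·∣ R ∷ ·∣ R ∷ []) ∷   -- ···|BRR
  (·∣ B  ∷ ·∣ R ∷ R ∣· ∷ []) ∷   -- ··R|BR·
  ( B ∣· ∷ ·∣ R ∷ ·∣ R ∷ []) ∷   -- B··|·RR
  (·∣ B  ∷ R ∣· ∷ ·∣ R ∷ []) ∷   -- ·R·|B·R
  (·∣ R  ∷ ·∣ B ∷ ·∣ R ∷ []) ∷   -- ···|RBR
  ( R ∣· ∷ ·∣ B ∷ ·∣ R ∷ []) ∷   -- R··|·BR
  (·∣ R  ∷ B ∣· ∷ ·∣ R ∷ []) ∷   -- ·B·|R·R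
  (·∣ R  ∷ ·∣ B ∷ R ∣· ∷ []) ∷   -- ··R|RB·
  []

{-# OPTIONS --safe #-}

-- Red bends suffice.  Hang one on a red tunnel leaving at the top or bottom
-- and it leaves on the other side instead; hang two on a red tunnel and it
-- zigzags to another row of its side, past tunnels leaving on the other side.
-- With the blue tunnel kept straight and up to mirror images, these moves link
-- all twelve patterns in a closed walk.  In each drawing all tunnels are at
-- distinct heights and all components at distinct abscissas, so that what is
-- left to verify is a finite computation.
module Submission where

open import Defs
open import Data.Fin using (Fin; zero; suc; #_; toℕ) renaming (_<_ to _<ᶠ_)
open import Data.Fin.Properties using (all?; any?) renaming (_≟_ to _≟ᶠ_; _<?_ to _<ᶠ?_)
open import Data.Integer using (ℤ; +_; _≤_; _<_)
open import Data.Integer.Properties using (_≟_; _≤?_; _<?_)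
open import Data.Nat using (ℕ; zero; suc; z≤n; s≤s; _+_) renaming (_≤_ to _≤ⁿ_)
open import Data.Nat.GeneralisedArithmetic using (fold)
open import Data.Nat.Properties
  using (+-identityʳ; +-cancelˡ-≤; +-monoˡ-≤; +-monoʳ-≤; ≤-trans; ≤-reflexive)
  renaming (_≟_ to _≟ⁿ_)
open import Data.Nat.Tactic.RingSolver using (solve-∀)
open import Data.Product using (Σ; ∃-syntax; _×_; _,_; proj₁; proj₂)
open import Data.Product.Properties using () renaming (≡-dec to ×-≡-dec)
open import Data.Sum using (_⊎_; inj₁; inj₂; [_,_]′)
open import Data.Sum.Properties using () renaming (≡-dec to ⊎-≡-dec)
open import Data.Vec using (Vec; []; _∷_; lookup; tabulate; replicate)
open import Data.Vec.Properties using (lookup∘tabulate; lookup-replicate)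
open import Data.Vec.Relation.Unary.All using ([]; _∷_)
open import Data.Vec.Relation.Unary.All.Properties using (tabulate⁻)
open import Data.Empty using (⊥-elim)
open import Function using (_∘_; id)
open import Function.Bundles using (mk⇔; mk↔ₛ′)
open import Relation.Binary.Definitions using (DecidableEquality)
open import Relation.Binary.PropositionalEquality
  using (_≡_; _≢_; refl; sym; trans; cong; subst)
open import Relation.Nullary using (Dec; no; ¬_; ¬?)
open import Relation.Nullary.Decidable using (map′; _×-dec_; _⊎-dec_; _→-dec_; True; toWitness)
open import Relation.Unary using (Decidable; _∈_)

-- Decision procedures for tunnels and their ends

_≟ᵉ_ : ∀ {m} → DecidableEquality (End m)
start s  ≟ᵉ start t  = map′ (cong start) (λ { refl → refl }) (s ≟ᶠ t)
start _  ≟ᵉ finish _ = no λ ()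
start _  ≟ᵉ outer _  = no λ ()
finish _ ≟ᵉ start _  = no λ ()
finish s ≟ᵉ finish t = map′ (cong finish) (λ { refl → refl }) (s ≟ᶠ t)
finish _ ≟ᵉ outer _  = no λ ()
outer _  ≟ᵉ start _  = no λ ()
outer _  ≟ᵉ finish _ = no λ ()
outer i  ≟ᵉ outer j  = map′ (cong outer) (λ { refl → refl }) (i ≟ᶠ j)

_≟ᵗ_ : ∀ {m} → DecidableEquality (Tunnel m)
_≟ᵗ_ = ⊎-≡-dec _≟ᶠ_ _≟ᶠ_

allEnds? : ∀ {m} {P : End m → Set} → Decidable P → Dec (∀ e → P e)
allEnds? P? = map′ (λ { (s , f , o) → λ { (start t) → s t ; (finish t) → f t ; (outer i) → o i } })
                   (λ p → p ∘ start , p ∘ finish , p ∘ outer)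
                   (all? (P? ∘ start) ×-dec all? (P? ∘ finish) ×-dec all? (P? ∘ outer))

allTunnels? : ∀ {m} {P : Tunnel m → Set} → Decidable P → Dec (∀ t → P t)
allTunnels? P? = map′ (λ { (f , o) → λ { (inj₁ t) → f t ; (inj₂ i) → o i } })
                      (λ p → p ∘ inj₁ , p ∘ inj₂)
                      (all? (P? ∘ inj₁) ×-dec all? (P? ∘ inj₂))

ray? : ∀ s a → Decidable (ray s a)
ray? left  a x = x ≤? a
ray? right a x = a ≤? x

-- Networks and drawings from finite data

-- Heights are stored per tunnel rather than per port, so both ends of an internal tunnel are level
-- by construction.
record Layout (P : Pattern) : Set where
  field
    {size internals} : ℕ
    parts   : Vec Component size
    wiring  : ∀ i → Vec (End internals) (arity (lookup parts i))
    -- The abscissa, bottom and top of each component.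
    frames  : Vec (ℕ × ℕ × ℕ) size
    rows    : Vec ℕ internals
    outRows : Vec ℕ 3

  Port : Set
  Port = Σ (Fin size) λ i → Fin (arity (lookup parts i))

  entry : Port → Entry
  entry (i , k) = lookup (entries (lookup parts i)) k

  wire : Port → End internals
  wire (i , k) = lookup (wiring i) k

  allPorts? : {Q : Port → Set} → Decidable Q → Dec (∀ p → Q p)
  allPorts? Q? = map′ (λ f p → f (proj₁ p) (proj₂ p)) (λ f i k → f (i , k))
                      (all? λ i → all? λ k → Q? (i , k))

  anyPort? : {Q : Port → Set} → Decidable Q → Dec (∃[ p ] Q p)
  anyPort? Q? = map′ (λ { (i , k , q) → (i , k) , q }) (λ { ((i , k) , q) → i , k , q })
                     (any? λ i → any? λ k → Q? (i , k))

  abscissa bottom top : Fin size → ℤ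
  abscissa i = + proj₁ (lookup frames i)
  bottom   i = + proj₁ (proj₂ (lookup frames i))
  top      i = + proj₂ (proj₂ (lookup frames i))

  level : Tunnel internals → ℤ
  level = [ (λ t → + lookup rows t) , (λ i → + lookup outRows i) ]′

  height : Port → ℤ
  height p = level (tunnelOf (wire p))

  Bijective : Set
  Bijective = (∀ e → ∃[ p ] wire p ≡ e) × (∀ p q → wire p ≡ wire q → p ≡ q)

  bijective? : Dec Bijective
  bijective? = allEnds? (λ e → anyPort? λ p → wire p ≟ᵉ e) ×-dec
    allPorts? λ p → allPorts? λ q → (wire p ≟ᵉ wire q) →-dec ×-≡-dec _≟ᶠ_ _≟ᶠ_ p q

  module _ (bij : Bijective) where

    portOf : End internals → Port
    portOf e = proj₁ (proj₁ bij e)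

    wire-portOf : ∀ e → wire (portOf e) ≡ e
    wire-portOf e = proj₂ (proj₁ bij e)

    -- Equations between whole vectors, so that one `refl` covers all tunnels at once even when some
    -- entries of the gadget are variables.
    RedInternals : Set
    RedInternals = tabulate (entry ∘ portOf ∘ start) ≡ replicate internals (·∣ R) ×
                   tabulate (entry ∘ portOf ∘ finish) ≡ replicate internals (R ∣·)

    Outer : Set
    Outer = tabulate (entry ∘ portOf ∘ outer) ≡ P

    network : RedInternals → Outer → Network P
    network (starts , finishes) outers = record
      { size        = size
      ; part        = lookup parts
      ; internals   = internals
      ; ends        = mk↔ₛ′ portOf wire (λ p → proj₂ bij _ p (wire-portOf (wire p))) wire-portOf
      ; start-side  = λ t → cong side (startEntry t)
      ; finish-side = λ t → cong side (finishEntry t)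
      ; same-color  = λ t → trans (cong color (startEntry t)) (sym (cong color (finishEntry t)))
      ; outer-entry = λ i → trans (sym (lookup∘tabulate (entry ∘ portOf ∘ outer) i)) (cong (λ es → lookup es i) outers)
      }
      where
      startEntry : ∀ t → entry (portOf (start t)) ≡ ·∣ R
      startEntry t = trans (sym (lookup∘tabulate (entry ∘ portOf ∘ start) t))
        (trans (cong (λ es → lookup es t) starts) (lookup-replicate t _))
      finishEntry : ∀ t → entry (portOf (finish t)) ≡ R ∣·
      finishEntry t = trans (sym (lookup∘tabulate (entry ∘ portOf ∘ finish) t))
        (trans (cong (λ es → lookup es t) finishes) (lookup-replicate t _))

    Reach : Tunnel internals → ℤ → Set
    Reach (inj₁ t) x = abscissa (proj₁ (portOf (start t))) ≤ x ×
                       x ≤ abscissa (proj₁ (portOf (finish t)))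
    Reach (inj₂ i) x = x ∈ ray (side (lookup P i)) (abscissa (proj₁ (portOf (outer i))))

    reach? : ∀ t → Decidable (Reach t)
    reach? (inj₁ t) x = (_ ≤? _) ×-dec (_ ≤? _)
    reach? (inj₂ i) x = ray? (side (lookup P i)) _ x

    -- The order of the alternatives matters: with the sides of some entries
    -- of P left variable, Reach only computes for the other tunnels.
    Clear : Fin size → Tunnel internals → Set
    Clear i t = (∃[ k ] tunnelOf (wire (i , k)) ≡ t) ⊎
                ¬ (bottom i ≤ level t × level t ≤ top i) ⊎
                ¬ Reach t (abscissa i)

    Framed : Set
    Framed = (∀ i → bottom i < top i) ×
             (∀ p → bottom (proj₁ p) ≤ height p × height p ≤ top (proj₁ p)) ×
             (∀ i k l → k <ᶠ l → height (i , l) < height (i , k))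

    -- Bodies at distinct abscissas cannot meet, nor can tunnels at distinct levels; only a body and
    -- a tunnel might, and `Clear` excludes that.
    Planar : Set
    Planar = Framed ×
             (∀ t → abscissa (proj₁ (portOf (start t))) < abscissa (proj₁ (portOf (finish t)))) ×
             (∀ i j → i <ᶠ j → level (inj₂ j) < level (inj₂ i)) ×
             (∀ i j → abscissa i ≡ abscissa j → i ≡ j) ×
             (∀ s t → level s ≡ level t → s ≡ t) ×
             (∀ i t → Clear i t)

    planar? : Dec Planar
    planar? =
      (all? (λ i → bottom i <? top i) ×-dec
       allPorts? (λ p → (bottom (proj₁ p) ≤? height p) ×-dec (height p ≤? top (proj₁ p))) ×-dec
       all? (λ i → all? λ k → all? λ l → (k <ᶠ? l) →-dec (height (i , l) <? height (i , k)))) ×-dec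
      all? (λ t → _ <? _) ×-dec
      all? (λ i → all? λ j → (i <ᶠ? j) →-dec (level (inj₂ j) <? level (inj₂ i))) ×-dec
      all? (λ i → all? λ j → (abscissa i ≟ abscissa j) →-dec (i ≟ᶠ j)) ×-dec
      allTunnels? (λ s → allTunnels? λ t → (level s ≟ level t) →-dec (s ≟ᵗ t)) ×-dec
      all? (λ i → allTunnels? λ t →
        any? (λ k → tunnelOf (wire (i , k)) ≟ᵗ t) ⊎-dec
        ¬? ((bottom i ≤? level t) ×-dec (level t ≤? top i)) ⊎-dec
        ¬? (reach? t (abscissa i)))

    drawing : Planar → (reds : RedInternals) (outers : Outer) → Drawing (network reds outers)
    drawing ((b<t , att , desc) , rightw , down , X-inj , level-inj , clear) reds outers = record
      { place            = place
      ; rightwards       = rightw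
      ; horizontal       = λ t → trans (height-portOf (start t)) (sym (height-portOf (finish t)))
      ; outer-descending = λ {i} {j} i<j →
          subst (_< _) (sym (height-portOf (outer j)))
            (subst (_ <_) (sym (height-portOf (outer i))) (down i j i<j))
      ; bodies-disjoint  = λ { {i} {j} i≢j ((x≡i , _) , (x≡j , _)) →
          i≢j (X-inj i j (trans (sym x≡i) x≡j)) }
      ; tunnels-disjoint = λ { {s} {t} s≢t (p∈s , p∈t) →
          s≢t (level-inj s t (trans (sym (segment-level s p∈s)) (segment-level t p∈t))) }
      ; body-tunnel      = meet
      }
      where
      place : ∀ i → Placement (lookup parts i)
      place i = record
        { abscissa   = abscissa i
        ; bottom     = bottom i
        ; top        = top i
        ; height     = λ k → height (i , k)
        ; bottom<top = b<t i
        ; attached   = λ k → att (i , k)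
        ; descending = λ {k} {l} → desc i k l
        }

      open Segments (network reds outers) place using (body; segment)

      height-portOf : ∀ e → height (portOf e) ≡ level (tunnelOf e)
      height-portOf e = cong (level ∘ tunnelOf) (wire-portOf e)

      segment-level : ∀ t {x y} → (x , y) ∈ segment t → y ≡ level t
      segment-level (inj₁ t) (y≡ , _) = trans y≡ (height-portOf (start t))
      segment-level (inj₂ i) (y≡ , _) = trans y≡ (height-portOf (outer i))

      segment-reach : ∀ t {x y} → (x , y) ∈ segment t → Reach t x
      segment-reach (inj₁ t) (_ , r) = r
      segment-reach (inj₂ i) (_ , r) = r

      meet : ∀ i t {p} → p ∈ body i → p ∈ segment t →
             ∃[ k ] tunnelOf (wire (i , k)) ≡ t × p ≡ (abscissa i , height (i , k))
      meet i t (refl , b≤y , y≤t) p∈t with clear i t | segment-level t p∈t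
      ... | inj₁ (k , refl)    | refl = k , refl , refl
      ... | inj₂ (inj₁ off)    | refl = ⊥-elim (off (b≤y , y≤t))
      ... | inj₂ (inj₂ ¬reach) | _    = ⊥-elim (¬reach (segment-reach t p∈t))

-- Flow through a red bend

opposite : Direction → Direction
opposite left  = right
opposite right = left

red : Side → Entry
red left  = R ∣·
red right = ·∣ R

red-conserved : ∀ s x → inflow₁ (red s) x + inflow₁ (flip (red s)) x ≡ 1
red-conserved left  left  = refl
red-conserved left  right = refl
red-conserved right left  = refl
red-conserved right right = refl

red-opposite : ∀ s x → inflow₁ (flip (red s)) (opposite x) ≡ inflow₁ (red s) x
red-opposite left  left  = refl
red-opposite left  right = refl
red-opposite right left  = refl
red-opposite right right = refl

-- Both ports of a bend are on the same side, so of two opposite directions exactly one points into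
-- it. The primed version lists the ports in the other order.
redTurn : ∀ s x → 1 ≤ⁿ inflow₁ (red s) x + (inflow₁ (red s) (opposite x) + 0)
redTurn left  left  = s≤s z≤n
redTurn left  right = s≤s z≤n
redTurn right left  = s≤s z≤n
redTurn right right = s≤s z≤n

redTurn′ : ∀ s x → 1 ≤ⁿ inflow₁ (red s) (opposite x) + (inflow₁ (red s) x + 0)
redTurn′ left  left  = s≤s z≤n
redTurn′ left  right = s≤s z≤n
redTurn′ right left  = s≤s z≤n
redTurn′ right right = s≤s z≤n

-- By `red-conserved`, an edge that brings 1 to its far end brings nothing to the bend, which must
-- then receive its inflow `v` through the other port. Hence a bend never delivers more than it
-- receives.
relay : ∀ s x {v} → 1 ≤ⁿ inflow₁ (red s) x + (v + 0) → inflow₁ (flip (red s)) x ≤ⁿ v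
relay s x {v} h = +-cancelˡ-≤ (inflow₁ (red s) x) _ _
  (subst (_≤ⁿ inflow₁ (red s) x + v) (sym (red-conserved s x))
    (subst (λ w → 1 ≤ⁿ inflow₁ (red s) x + w) (+-identityʳ v) h))

relay′ : ∀ s x {v} → 1 ≤ⁿ v + (inflow₁ (red s) x + 0) → inflow₁ (flip (red s)) x ≤ⁿ v
relay′ s x {v} h = relay s x (≤-trans h (≤-reflexive (lemma v _)))
  where
  lemma : ∀ a b → a + (b + 0) ≡ b + (a + 0)
  lemma = solve-∀

swap-sum : ∀ a b c → a + (b + c) ≡ b + (a + c)
swap-sum = solve-∀

rotate-sum : ∀ a b c → a + (b + (c + 0)) ≡ c + (a + (b + 0))
rotate-sum = solve-∀

-- The moves as assemblies

module _ {G O : Pattern} where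

  -- For a concrete layout the two `True` arguments evaluate to the unit type and are inferred, so
  -- the geometric checks are done by the type checker.
  build : ∀ {P} → IsAnd P → (L : Layout P) → let open Layout L in
          {bij : True bijective?} {planar : True (planar? (toWitness bij))} →
          (reds : RedInternals (toWitness bij)) (outers : Outer (toWitness bij)) →
          (∀ i → Available G O (lookup parts i)) →
          Network.BehavesAsGadget (network (toWitness bij) reds outers) →
          Constructible G O P
  build isAnd L {bij} {planar} reds outers available behaves =
    assemble (inj₁ isAnd) (network (toWitness bij) reds outers) available
      (drawing (toWitness bij) (toWitness planar) reds outers) behaves
    where open Layout L

  -- An available gadget may be a mirror image rather than an assembly; drawing it as the only part,
  -- without internal tunnels, makes it an assembly.
  standing : ∀ {P} → IsAnd P → Available G O (gadget P) → Constructible G O P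
  standing {e ∷ f ∷ g ∷ []} isAnd a = build isAnd layout (refl , refl) refl
    (λ { zero → a })
    λ d → mk⇔ (λ { (_ , sat) → sat zero }) (λ h → (λ ()) , λ { zero → h })
    where
    layout : Layout (e ∷ f ∷ g ∷ [])
    layout = record
      { parts   = gadget (e ∷ f ∷ g ∷ []) ∷ []
      ; wiring  = λ { zero → outer (# 0) ∷ outer (# 1) ∷ outer (# 2) ∷ [] }
      ; frames  = (0 , 1 , 3) ∷ []
      ; rows    = []
      ; outRows = 3 ∷ 2 ∷ 1 ∷ []
      }

  -- The bend stands to the left of the gadget and above the rows of `e` and `f`, which may thus
  -- leave on either side. The new external tunnel passes over the top of the gadget.
  overTop : ∀ {e f} → IsAnd (·∣ R ∷ e ∷ f ∷ []) →
            Available G O (gadget (R ∣· ∷ e ∷ f ∷ [])) → Constructible G O (·∣ R ∷ e ∷ f ∷ [])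
  overTop {e} {f} isAnd g = build isAnd layout (refl , refl) refl
    (λ { zero → g ; (suc zero) → mirrored bend })
    λ d → let r = inflow₁ (·∣ R) (d (# 0))
              m = inflow₁ e (d (# 1))
              n = inflow₁ f (d (# 2)) in
      mk⇔
        (λ { (t , sat) → ≤-trans (sat (# 0)) (+-monoˡ-≤ (m + (n + 0)) (relay′ right (t (# 0)) {r} (sat (# 1)))) })
        -- The path reverses at the bend, so the internal edge points opposite to the external one
        -- and the gadget sees the same inflow.
        (λ h → (λ _ → opposite (d (# 0))) , λ
          { zero       → subst (λ u → 2 ≤ⁿ u + (m + (n + 0))) (sym (red-opposite right (d (# 0)))) h
          ; (suc zero) → redTurn right (d (# 0)) })
    where
    layout : Layout (·∣ R ∷ e ∷ f ∷ [])
    layout = record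
      { parts   = gadget (R ∣· ∷ e ∷ f ∷ []) ∷ mirror redBend ∷ []
      ; wiring  = λ { zero       → finish (# 0) ∷ outer (# 1) ∷ outer (# 2) ∷ []
                    ; (suc zero) → outer (# 0) ∷ start (# 0) ∷ [] }
      ; frames  = (1 , 1 , 3) ∷ (0 , 3 , 4) ∷ []
      ; rows    = 3 ∷ []
      ; outRows = 4 ∷ 2 ∷ 1 ∷ []
      }

  -- `overTop` upside down: the bend lies below the rows of `e` and `f`.
  underBottom : ∀ {e f} → IsAnd (e ∷ f ∷ ·∣ R ∷ []) →
                Available G O (gadget (e ∷ f ∷ R ∣· ∷ [])) → Constructible G O (e ∷ f ∷ ·∣ R ∷ [])
  underBottom {e} {f} isAnd g = build isAnd layout (refl , refl) refl
    (λ { zero → g ; (suc zero) → mirrored bend })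
    λ d → let m = inflow₁ e (d (# 0))
              n = inflow₁ f (d (# 1)) in
      mk⇔
        (λ { (t , sat) → ≤-trans (sat (# 0))
               (+-monoʳ-≤ m (+-monoʳ-≤ n (+-monoˡ-≤ 0 (relay right (t (# 0)) (sat (# 1)))))) })
        (λ h → (λ _ → opposite (d (# 2))) , λ
          { zero       → subst (λ u → 2 ≤ⁿ m + (n + (u + 0))) (sym (red-opposite right (d (# 2)))) h
          ; (suc zero) → redTurn′ right (d (# 2)) })
    where
    layout : Layout (e ∷ f ∷ ·∣ R ∷ [])
    layout = record
      { parts   = gadget (e ∷ f ∷ R ∣· ∷ []) ∷ mirror redBend ∷ []
      ; wiring  = λ { zero       → outer (# 0) ∷ outer (# 1) ∷ finish (# 0) ∷ []
                    ; (suc zero) → start (# 0) ∷ outer (# 2) ∷ [] }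
      ; frames  = (1 , 2 , 4) ∷ (0 , 1 , 2) ∷ []
      ; rows    = 2 ∷ []
      ; outRows = 4 ∷ 3 ∷ 1 ∷ []
      }

  -- The red tunnel runs left to the first bend, back right to the second, and left again below the
  -- row of `c`. The second bend stands left of the gadget and spans that row, which is harmless
  -- because `c` leaves on the right.
  zigzag₀₁ : ∀ {c e} → IsAnd (·∣ c ∷ R ∣· ∷ e ∷ []) →
             Available G O (gadget (R ∣· ∷ ·∣ c ∷ e ∷ [])) → Constructible G O (·∣ c ∷ R ∣· ∷ e ∷ [])
  zigzag₀₁ {c} {e} isAnd g = build isAnd layout (refl , refl) refl
    (λ { zero → g ; (suc zero) → mirrored bend ; (suc (suc zero)) → bend })
    λ d → let r = inflow₁ (R ∣·) (d (# 1))
              m = inflow₁ (·∣ c) (d (# 0))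
              n = inflow₁ e (d (# 2)) + 0
              -- The gadget and the assembly list the same three inflows in different row orders.
              q = swap-sum r m n in
      mk⇔
        (λ { (t , sat) → ≤-trans (sat (# 0)) (≤-trans
               (+-monoˡ-≤ (m + n) (≤-trans (relay right (t (# 0)) (sat (# 1))) (relay left (t (# 1)) (sat (# 2)))))
               (≤-reflexive q)) })
        -- Each bend reverses the direction: tunnel 1 opposes the external edge, and tunnel 0 agrees
        -- with it again.
        (λ h → lookup (d (# 1) ∷ opposite (d (# 1)) ∷ []) , λ
          { zero             → subst (2 ≤ⁿ_) (sym q) h
          ; (suc zero)       → redTurn right (d (# 1))
          ; (suc (suc zero)) → redTurn′ left (d (# 1)) })
    where
    layout : Layout (·∣ c ∷ R ∣· ∷ e ∷ [])
    layout = record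
      { parts   = gadget (R ∣· ∷ ·∣ c ∷ e ∷ []) ∷ mirror redBend ∷ redBend ∷ []
      ; wiring  = λ { zero             → finish (# 0) ∷ outer (# 0) ∷ outer (# 2) ∷ []
                    ; (suc zero)       → start (# 0) ∷ start (# 1) ∷ []
                    ; (suc (suc zero)) → finish (# 1) ∷ outer (# 1) ∷ [] }
      ; frames  = (2 , 1 , 5) ∷ (0 , 4 , 5) ∷ (1 , 2 , 4) ∷ []
      ; rows    = 5 ∷ 4 ∷ []
      ; outRows = 3 ∷ 2 ∷ 1 ∷ []
      }

  zigzag₁₂ : ∀ {c e} → IsAnd (e ∷ ·∣ c ∷ R ∣· ∷ []) →
             Available G O (gadget (e ∷ R ∣· ∷ ·∣ c ∷ [])) → Constructible G O (e ∷ ·∣ c ∷ R ∣· ∷ [])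
  zigzag₁₂ {c} {e} isAnd g = build isAnd layout (refl , refl) refl
    (λ { zero → g ; (suc zero) → mirrored bend ; (suc (suc zero)) → bend })
    λ d → let r = inflow₁ (R ∣·) (d (# 2))
              m = inflow₁ e (d (# 0))
              n = inflow₁ (·∣ c) (d (# 1))
              q = cong (_+_ m) (swap-sum r n 0) in
      mk⇔
        (λ { (t , sat) → ≤-trans (sat (# 0)) (≤-trans
               (+-monoʳ-≤ m (+-monoˡ-≤ (n + 0)
                 (≤-trans (relay right (t (# 0)) (sat (# 1))) (relay left (t (# 1)) (sat (# 2))))))
               (≤-reflexive q)) })
        (λ h → lookup (d (# 2) ∷ opposite (d (# 2)) ∷ []) , λ
          { zero             → subst (2 ≤ⁿ_) (sym q) h
          ; (suc zero)       → redTurn right (d (# 2))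
          ; (suc (suc zero)) → redTurn′ left (d (# 2)) })
    where
    layout : Layout (e ∷ ·∣ c ∷ R ∣· ∷ [])
    layout = record
      { parts   = gadget (e ∷ R ∣· ∷ ·∣ c ∷ []) ∷ mirror redBend ∷ redBend ∷ []
      ; wiring  = λ { zero             → outer (# 0) ∷ finish (# 0) ∷ outer (# 1) ∷ []
                    ; (suc zero)       → start (# 0) ∷ start (# 1) ∷ []
                    ; (suc (suc zero)) → finish (# 1) ∷ outer (# 2) ∷ [] }
      ; frames  = (2 , 2 , 5) ∷ (0 , 3 , 4) ∷ (1 , 1 , 3) ∷ []
      ; rows    = 4 ∷ 3 ∷ []
      ; outRows = 5 ∷ 2 ∷ 1 ∷ []
      }

  -- Here the second bend spans the rows of both other tunnels, so both must leave on the right.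
  zigzag₂₀ : ∀ {c c′} → IsAnd (R ∣· ∷ ·∣ c ∷ ·∣ c′ ∷ []) →
             Available G O (gadget (·∣ c ∷ ·∣ c′ ∷ R ∣· ∷ [])) →
             Constructible G O (R ∣· ∷ ·∣ c ∷ ·∣ c′ ∷ [])
  zigzag₂₀ {c} {c′} isAnd g = build isAnd layout (refl , refl) refl
    (λ { zero → g ; (suc zero) → mirrored bend ; (suc (suc zero)) → bend })
    λ d → let r = inflow₁ (R ∣·) (d (# 0))
              m = inflow₁ (·∣ c) (d (# 1))
              n = inflow₁ (·∣ c′) (d (# 2))
              q = rotate-sum m n r in
      mk⇔
        (λ { (t , sat) → ≤-trans (sat (# 0)) (≤-trans
               (+-monoʳ-≤ m (+-monoʳ-≤ n (+-monoˡ-≤ 0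
                 (≤-trans (relay′ right (t (# 0)) (sat (# 1))) (relay′ left (t (# 1)) (sat (# 2)))))))
               (≤-reflexive q)) })
        (λ h → lookup (d (# 0) ∷ opposite (d (# 0)) ∷ []) , λ
          { zero             → subst (2 ≤ⁿ_) (sym q) h
          ; (suc zero)       → redTurn′ right (d (# 0))
          ; (suc (suc zero)) → redTurn left (d (# 0)) })
    where
    layout : Layout (R ∣· ∷ ·∣ c ∷ ·∣ c′ ∷ [])
    layout = record
      { parts   = gadget (·∣ c ∷ ·∣ c′ ∷ R ∣· ∷ []) ∷ mirror redBend ∷ redBend ∷ []
      ; wiring  = λ { zero             → outer (# 1) ∷ outer (# 2) ∷ finish (# 0) ∷ []
                    ; (suc zero)       → start (# 1) ∷ start (# 0) ∷ []
                    ; (suc (suc zero)) → outer (# 0) ∷ finish (# 1) ∷ [] }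
      ; frames  = (2 , 1 , 4) ∷ (0 , 1 , 2) ∷ (1 , 2 , 5) ∷ []
      ; rows    = 1 ∷ 2 ∷ []
      ; outRows = 5 ∷ 4 ∷ 3 ∷ []
      }

-- The walk through the twelve gadgets

-- The closed walk 1, 2, 4, 11, 7, 8, 6, 5, 10, 9, 12, 3, 1 in the numbering of
-- the paper.
next : Fin 12 → Fin 12
next = lookup (# 1 ∷ # 3 ∷ # 0 ∷ # 10 ∷ # 9 ∷ # 4 ∷ # 7 ∷ # 5 ∷ # 11 ∷ # 8 ∷ # 6 ∷ # 2 ∷ [])

-- The walk is a single cycle of length 12, so fewer than 12 steps lead from any gadget to any
-- other, and evaluation confirms it.
next-reaches : ∀ i j → ∃[ n ] fold i next (toℕ {12} n) ≡ j
next-reaches = toWitness {a? = all? λ i → all? λ j → any? λ n → fold i next (toℕ {12} n) ≟ᶠ j} _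

andGadgets-and : ∀ i → IsAnd (lookup andGadgets i)
andGadgets-and = toWitness {a? = all? λ i → blues (lookup andGadgets i) ≟ⁿ 1} _

module _ {G O : Pattern} where

  Reached : Fin 12 → Set
  Reached i = Available G O (gadget (lookup andGadgets i))

  step : ∀ i → Reached i → Reached (next i)
  -- `tabulate⁻` turns the list of moves, one per gadget in the order of `andGadgets`, into a
  -- function on `Fin 12`.
  step = tabulate⁻ {P = λ i → Reached i → Reached (next i)} {f = id}
    ( (λ g → constructed (zigzag₀₁ refl g))
    ∷ (λ g → constructed (overTop refl (mirrored g)))
    ∷ (λ g → mirrored (constructed (overTop refl (mirrored g))))
    ∷ (λ g → mirrored (constructed (zigzag₁₂ refl (mirrored g))))
    -- The bottom red tunnel is first turned to the other side, then zigzags to the top row.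
    ∷ (λ g → constructed (zigzag₂₀ refl (mirrored (constructed (underBottom refl (mirrored g))))))
    ∷ (λ g → constructed (underBottom refl g))
    ∷ (λ g → constructed (underBottom refl (mirrored g)))
    ∷ (λ g → constructed (zigzag₁₂ refl g))
    ∷ (λ g → mirrored (constructed (underBottom refl (mirrored g))))
    ∷ (λ g → constructed (overTop refl g))
    ∷ (λ g → mirrored (constructed (zigzag₀₁ refl (mirrored g))))
    -- The red tunnel zigzags from the bottom row to the top and is then turned to the right.
    ∷ (λ g → constructed (overTop refl (constructed (zigzag₂₀ refl g))))
    ∷ [])

  steps : ∀ i n → Reached i → Reached (fold i next n)
  steps i zero    g = g
  steps i (suc n) g = step (fold i next n) (steps i n g)

  allReached : ∀ i j → Reached i → Reached j
  allReached i j g = let n , eq = next-reaches i j in subst Reached eq (steps i (toℕ n) g)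

lemma3p8 : (i j : Fin 12) → i ≢ j → (O : Pattern) → IsOr O →
    Constructible (lookup andGadgets i) O (lookup andGadgets j)
lemma3p8 i j _ O _ =
  standing (andGadgets-and j) (allReached {lookup andGadgets i} {O} i j source)
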